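{- If $n \geq 1$ is an integer and $A\subseteq\omega$ is an $n$-c.e. set that has an asymptotic density, then $\rho(A)$ is a difference of two left-$\Pi^0_2$ reals.
   Context: For $X \subseteq \omega=\{0,1,2,\dots\}$ and an integer $m>0$, let $\rho_m(X) = |\{j \in X : j < m\}|/m$. The set $X$ has a (asymptotic) density if $\lim_m \rho_m(X)$ exists, and the density is then $\rho(X) = \lim_m \rho_m(X)$. Sets are identified with their characteristic functions. For a natural number $n$, a set $A \subseteq \omega$ is $n$-c.e. if there is a computable function $g:\omega\times\omega\to\{0,1\}$ such that for all $x$: $g(x,0)=0$, $A(x)=\lim_s g(x,s)$, and $|\{s : g(x,s) \neq g(x,s+1)\}| \leq n$. A real $r$ is left-$\Pi^0_2$ if its left Dedekind cut $\{q \in \mathbb{Q} : q < r\}$ is a $\Pi^0_2$ set. -}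

module Defs where

open import Data.Bool using (Bool; true; false)
open import Data.Fin using (Fin)
open import Data.Integer using (ℤ; +_; -[1+_])
open import Data.List using (List; length; filterᵇ; upTo)
open import Data.List.Membership.Propositional using (_∈_)
open import Data.Nat as ℕ using (ℕ; suc; NonZero)
import Data.Nat.Properties as ℕ
open import Data.Product using (Σ-syntax; ∃-syntax; _×_; _,_)
open import Data.Rational using (ℚ; 0ℚ; ½; _+_; _*_; _-_; _<_; _≤_; ∣_∣; _/_; ↥_; ↧ₙ_)
open import Data.Rational.Properties
  using (+-mono-<; ∣p-q∣≤∣p∣+∣q∣; *-monoʳ-<-pos; +-inverseʳ; module ≤-Reasoning)
open import Data.Rational.Solver using (module +-*-Solver)
open import Data.Vec using (Vec; []; _∷_; lookup)
open import Data.Vec.Relation.Binary.Pointwise.Inductive using (Pointwise)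
open import Function.Bundles using (_⇔_)
open import Relation.Binary.PropositionalEquality using (_≡_; _≢_; refl; sym; cong; subst)

-- Programs for (and below, big-step evaluation of) the k-ary partial (μ-)recursive functions.
data Rec : ℕ → Set where
  zer  : Rec 0
  succ : Rec 1
  proj : ∀ {k} → Fin k → Rec k
  comp : ∀ {k m} → Rec m → Vec (Rec k) m → Rec k
  prec : ∀ {k} → Rec k → Rec (2 ℕ.+ k) → Rec (suc k)
  mini : ∀ {k} → Rec (suc k) → Rec k

infix 4 _[_]⇓_

data _[_]⇓_ : ∀ {k} → Rec k → Vec ℕ k → ℕ → Set where
  ⇓zer   : zer [ [] ]⇓ 0
  ⇓succ  : ∀ {x} → succ [ x ∷ [] ]⇓ suc x
  ⇓proj  : ∀ {k} {i : Fin k} {xs} → proj i [ xs ]⇓ lookup xs i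
  ⇓comp  : ∀ {k m} {f : Rec m} {gs : Vec (Rec k) m} {xs ys z} →
           Pointwise (λ g y → g [ xs ]⇓ y) gs ys →
           f [ ys ]⇓ z →
           comp f gs [ xs ]⇓ z
  ⇓prec₀ : ∀ {k} {f : Rec k} {g xs y} →
           f [ xs ]⇓ y →
           prec f g [ 0 ∷ xs ]⇓ y
  ⇓precₛ : ∀ {k} {f : Rec k} {g xs n y z} →
           prec f g [ n ∷ xs ]⇓ y →
           g [ n ∷ y ∷ xs ]⇓ z →
           prec f g [ suc n ∷ xs ]⇓ z
  ⇓mini  : ∀ {k} {f : Rec (suc k)} {xs n} →
           (∀ i → i ℕ.< n → ∃[ y ] f [ i ∷ xs ]⇓ suc y) →
           f [ n ∷ xs ]⇓ 0 →
           mini f [ xs ]⇓ n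

bit : Bool → ℕ
bit false = 0
bit true  = 1

Computable : ∀ {k} → (Vec ℕ k → Bool) → Set
Computable {k} f = Σ[ c ∈ Rec k ] (∀ xs → c [ xs ]⇓ bit (f xs))

onVec₂ : (ℕ → ℕ → Bool) → Vec ℕ 2 → Bool
onVec₂ g (x ∷ s ∷ []) = g x s

-- The set { s | P s } has at most n elements.
AtMost : ℕ → (ℕ → Set) → Set
AtMost n P = Σ[ xs ∈ List ℕ ] (length xs ℕ.≤ n × (∀ s → P s → s ∈ xs))

-- A set A is its characteristic function; A(x) = lim_s g(x,s) is convergence
-- in the discrete space {0,1}.
_-CE_ : ℕ → (ℕ → Bool) → Set
n -CE A =
  Σ[ g ∈ (ℕ → ℕ → Bool) ]
    Computable (onVec₂ g) ×
    (∀ x → g x 0 ≡ false) ×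
    (∀ x → ∃[ s₀ ] (∀ s → s₀ ℕ.≤ s → g x s ≡ A x)) ×
    (∀ x → AtMost n (λ s → g x s ≢ g x (suc s)))

-- Effective injective coding of ℚ: a rational in lowest terms is coded by its
-- numerator (nonnegative ones as even, negative ones as odd numbers) and its
-- positive denominator.
codeℤ : ℤ → ℕ
codeℤ (+ n)    = 2 ℕ.* n
codeℤ -[1+ n ] = suc (2 ℕ.* n)

codeℚ : ℚ → Vec ℕ 2
codeℚ q = codeℤ (↥ q) ∷ ↧ₙ q ∷ []

Π⁰₂ : (ℚ → Set) → Set
Π⁰₂ S =
  Σ[ R ∈ (Vec ℕ 4 → Bool) ]
    Computable R ×
    (∀ q → S q ⇔ (∀ a → ∃[ b ] R (a ∷ b ∷ codeℚ q) ≡ true))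

-- Real numbers are Cauchy sequences of rationals modulo null sequences (_≃_).
Cauchy : (ℕ → ℚ) → Set
Cauchy x = ∀ ε → 0ℚ < ε →
  ∃[ N ] (∀ m n → N ℕ.≤ m → N ℕ.≤ n → ∣ x m - x n ∣ < ε)

record ℝ : Set where
  constructor mkℝ
  field
    seq    : ℕ → ℚ
    cauchy : Cauchy seq

open ℝ public

infix 4 _≃_ _<ᴿ_
infixl 6 _-ᴿ_

_≃_ : ℝ → ℝ → Set
r ≃ s = ∀ ε → 0ℚ < ε → ∃[ N ] (∀ n → N ℕ.≤ n → ∣ seq r n - seq s n ∣ < ε)

_<ᴿ_ : ℝ → ℝ → Set
r <ᴿ s = ∃[ ε ] (0ℚ < ε × ∃[ N ] (∀ n → N ℕ.≤ n → seq r n + ε ≤ seq s n))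

fromℚ : ℚ → ℝ
fromℚ q = mkℝ (λ _ → q)
  (λ ε 0<ε → 0 , λ _ _ _ _ → subst (λ z → ∣ z ∣ < ε) (sym (+-inverseʳ q)) 0<ε)

_-ᴿ_ : ℝ → ℝ → ℝ
r -ᴿ s = mkℝ (λ n → seq r n - seq s n) diff-cauchy
  where
  open +-*-Solver

  regroup : ∀ a b c d → (a - b) - (c - d) ≡ (a - c) - (b - d)
  regroup = solve 4 (λ a b c d → (a :- b) :- (c :- d) := (a :- c) :- (b :- d)) refl

  halves : ∀ ε → ½ * ε + ½ * ε ≡ ε
  halves = solve 1 (λ e → con ½ :* e :+ con ½ :* e := e) refl

  half-pos : ∀ ε → 0ℚ < ε → 0ℚ < ½ * ε
  half-pos ε = *-monoʳ-<-pos ½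

  diff-cauchy : Cauchy (λ n → seq r n - seq s n)
  diff-cauchy ε 0<ε
    with cauchy r (½ * ε) (half-pos ε 0<ε) | cauchy s (½ * ε) (half-pos ε 0<ε)
  ... | N , hr | M , hs = N ℕ.⊔ M , λ m n m≥ n≥ → begin-strict
    ∣ (seq r m - seq s m) - (seq r n - seq s n) ∣
      ≡⟨ cong ∣_∣ (regroup (seq r m) (seq s m) (seq r n) (seq s n)) ⟩
    ∣ (seq r m - seq r n) - (seq s m - seq s n) ∣
      ≤⟨ ∣p-q∣≤∣p∣+∣q∣ (seq r m - seq r n) (seq s m - seq s n) ⟩
    ∣ seq r m - seq r n ∣ + ∣ seq s m - seq s n ∣
      <⟨ +-mono-< (hr m n (ℕ.m⊔n≤o⇒m≤o N M m≥) (ℕ.m⊔n≤o⇒m≤o N M n≥))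
                  (hs m n (ℕ.m⊔n≤o⇒n≤o N M m≥) (ℕ.m⊔n≤o⇒n≤o N M n≥)) ⟩
    ½ * ε + ½ * ε
      ≡⟨ halves ε ⟩
    ε ∎
    where open ≤-Reasoning

-- Convergence of a sequence of rationals to a real, i.e. |aₘ - r| < ε eventually.
_⟶_ : (ℕ → ℚ) → ℝ → Set
a ⟶ r = ∀ ε → 0ℚ < ε → ∃[ N ] (∀ m → N ℕ.≤ m →
  fromℚ (a m - ε) <ᴿ r × r <ᴿ fromℚ (a m + ε))

LeftΠ⁰₂ : ℝ → Set
LeftΠ⁰₂ r = Π⁰₂ (λ q → fromℚ q <ᴿ r)

partialDensity : (ℕ → Bool) → (m : ℕ) → .{{NonZero m}} → ℚ
partialDensity X m = + length (filterᵇ X (upTo m)) / m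

-- The sequence is indexed from m = 1.
HasDensity : (ℕ → Bool) → ℝ → Set
HasDensity X r = (λ m → partialDensity X (suc m)) ⟶ r

{-# OPTIONS --safe #-}
-- Let u(x) and d(x) be the numbers of changes 0 → 1 and 1 → 0 in the approximation of
-- A(x). Both are at most n, and u = A + d because the approximation starts at 0. The
-- averages u_m and d_m over {0,…,m} need not converge, but u_m - d_m tends to ρ(A), so
-- ρ(A) = limsup u_m - limsup d_m. As u_m is a supremum of computable stages, the cut
-- { q | q ≤ u_m for infinitely many m } is Π⁰₂, and it differs from { q | q < limsup u_m }
-- by at most one rational; likewise for d_m.
module Submission where

open import Algebra.Properties.CommutativeSemigroup using (interchange; xy∙z≈xz∙y)
open import Axiom.DoubleNegationElimination using (em⇒dne)
open import Axiom.ExcludedMiddle using (ExcludedMiddle)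
open import Data.Bool using (Bool; true; false; not; _∧_)
open import Data.Bool.Properties using (T-≡)
open import Data.Fin using (Fin; zero; suc)
import Data.Fin.Properties as Fin
open import Data.List as List using (List; []; _∷_; _∷ʳ_; length; filterᵇ; upTo)
open import Data.List.Membership.Propositional using (_∈_)
open import Data.List.Membership.Propositional.Properties using (∈-filter⁻; ∈-lookup)
open import Data.List.Membership.Setoid.Properties using (index-injective)
open import Data.List.Properties using (upTo-∷ʳ; filter-++; length-++)
import Data.List.Relation.Unary.All as All
open import Data.List.Relation.Unary.AllPairs using (_∷_)
open import Data.List.Relation.Unary.Any using (index)
open import Data.List.Relation.Unary.Unique.Propositional using (Unique)
import Data.List.Relation.Unary.Unique.Propositional.Properties as Unique
open import Data.Nat as ℕ using (ℕ; zero; suc)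
import Data.Nat.Properties as ℕ
open import Data.Product using (Σ-syntax; ∃-syntax; _×_; _,_; proj₁; proj₂)
import Data.Rational as ℚ
import Data.Rational.Unnormalised as ℚᵘ
import Data.Rational.Unnormalised.Properties as ℚᵘ
open import Data.Sum using (inj₁; inj₂)
open import Data.Vec using (Vec; []; _∷_; head; tail; lookup; tabulate)
open import Data.Vec.Properties using (∷-injective)
open import Data.Vec.Relation.Binary.Pointwise.Inductive using (Pointwise; []; _∷_)
open import Function.Base using (_∘_; case_of_)
open import Function.Bundles using (_⇔_; mk⇔; Equivalence)
open import Level using (0ℓ)
open import Relation.Binary.PropositionalEquality
open import Relation.Nullary using (¬_; Dec; yes; no)
open import Relation.Nullary.Decidable using (T?)
open import Relation.Nullary.Negation using (contradiction)
open import Defs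

-- Closure properties of computable functions.

module _ where

  open import Data.Nat
  open import Data.Nat.Properties

  ∑< : ℕ → (ℕ → ℕ) → ℕ
  ∑< zero    f = 0
  ∑< (suc n) f = ∑< n f + f n

  -- `Computable f` unfolds to `Computableℕ (bit ∘ f)`, so the closure properties below apply to
  -- decidable relations as well.
  Computableℕ : ∀ {k} → (Vec ℕ k → ℕ) → Set
  Computableℕ {k} f = Σ[ c ∈ Rec k ] (∀ xs → c [ xs ]⇓ f xs)

  module _ {k : ℕ} where

    computable-≗ : {f g : Vec ℕ k → ℕ} → f ≗ g → Computableℕ f → Computableℕ g
    computable-≗ f≗g (c , c⇓) = c , λ xs → subst (c [ xs ]⇓_) (f≗g xs) (c⇓ xs)

    var : (i : Fin k) → Computableℕ (λ xs → lookup xs i)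
    var i = proj i , λ _ → ⇓proj

    apply₀ : {f : Vec ℕ 0 → ℕ} → Computableℕ f → Computableℕ {k} (λ _ → f [])
    apply₀ (c , c⇓) = comp c [] , λ _ → ⇓comp [] (c⇓ _)

    apply₁ : {f : Vec ℕ 1 → ℕ} {g : Vec ℕ k → ℕ} →
             Computableℕ f → Computableℕ g → Computableℕ (λ xs → f (g xs ∷ []))
    apply₁ (c , c⇓) (d , d⇓) = comp c (d ∷ []) , λ xs → ⇓comp (d⇓ xs ∷ []) (c⇓ _)

    apply₂ : {f : Vec ℕ 2 → ℕ} {g h : Vec ℕ k → ℕ} →
             Computableℕ f → Computableℕ g → Computableℕ h →
             Computableℕ (λ xs → f (g xs ∷ h xs ∷ []))
    apply₂ (c , c⇓) (d , d⇓) (e , e⇓) =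
      comp c (d ∷ e ∷ []) , λ xs → ⇓comp (d⇓ xs ∷ e⇓ xs ∷ []) (c⇓ _)

  -- `comp` has to pass unchanged arguments on explicitly, as a vector of projections. The free
  -- index map `ι` makes induction on `xs` possible, because the tail is read through `ι ∘ suc`.
  ⇓projs : ∀ {k l} (ι : Fin k → Fin l) (xs : Vec ℕ k) {ys : Vec ℕ l} →
           (∀ i → lookup ys (ι i) ≡ lookup xs i) →
           Pointwise (λ g y → g [ ys ]⇓ y) (tabulate (proj ∘ ι)) xs
  ⇓projs ι []       eq = []
  ⇓projs ι (x ∷ xs) eq = subst (proj (ι zero) [ _ ]⇓_) (eq zero) ⇓proj
                       ∷ ⇓projs (ι ∘ suc) xs (eq ∘ suc)

  module _ {k : ℕ} {f : Vec ℕ (suc k) → ℕ} where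

    substHead : {g : Vec ℕ k → ℕ} →
                Computableℕ f → Computableℕ g → Computableℕ (λ xs → f (g xs ∷ xs))
    substHead (c , c⇓) (d , d⇓) =
      comp c (d ∷ tabulate proj) , λ xs → ⇓comp (d⇓ xs ∷ ⇓projs _ xs (λ _ → refl)) (c⇓ _)

    -- In a primitive recursion the accumulated value sits in second place. Dropping it there lets a
    -- summand ignore the partial sum.
    skipSecond : Computableℕ f → Computableℕ (λ xs → f (head xs ∷ tail (tail xs)))
    skipSecond (c , c⇓) =
      comp c (proj zero ∷ tabulate (λ i → proj (suc (suc i)))) ,
      λ { (_ ∷ _ ∷ xs) → ⇓comp (⇓proj ∷ ⇓projs _ xs (λ _ → refl)) (c⇓ _) }

  -- The step function `G` has to be right only at the accumulated value `F n xs`, the one value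
  -- that the recursion ever feeds to it.
  recursion : ∀ {k} (F : ℕ → Vec ℕ k → ℕ) {G : Vec ℕ (2 + k) → ℕ} →
              Computableℕ (F 0) → Computableℕ G →
              (∀ n xs → G (n ∷ F n xs ∷ xs) ≡ F (suc n) xs) →
              Computableℕ (λ xs → F (head xs) (tail xs))
  recursion F (c , c⇓) (d , d⇓) step = prec c d , λ { (n ∷ xs) → eval n xs }
    where
    eval : ∀ n xs → prec c d [ n ∷ xs ]⇓ F n xs
    eval zero    xs = ⇓prec₀ (c⇓ xs)
    eval (suc n) xs = subst (_ [ _ ]⇓_) (step n xs) (⇓precₛ (eval n xs) (d⇓ _))

  module _ {k : ℕ} where

    const : ∀ n → Computableℕ {k} (λ _ → n)
    const zero    = apply₀ {f = λ _ → 0} (zer , λ { [] → ⇓zer })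
    const (suc n) = apply₁ {f = λ xs → suc (head xs)} (succ , λ { (_ ∷ []) → ⇓succ }) (const n)

    sucᶜ : {f : Vec ℕ k → ℕ} → Computableℕ f → Computableℕ (suc ∘ f)
    sucᶜ = apply₁ {f = λ xs → suc (head xs)} (succ , λ { (_ ∷ []) → ⇓succ })

  infixl 6 _+ᶜ_ _∸ᶜ_
  infixl 7 _*ᶜ_

  _+ᶜ_ : ∀ {k} {f g : Vec ℕ k → ℕ} →
         Computableℕ f → Computableℕ g → Computableℕ (λ xs → f xs + g xs)
  _+ᶜ_ = apply₂ (recursion (λ n xs → n + head xs)
           (computable-≗ (λ { (_ ∷ []) → refl }) (var zero))
           (sucᶜ (var (suc zero)))
           (λ { _ (_ ∷ []) → refl }))

  _*ᶜ_ : ∀ {k} {f g : Vec ℕ k → ℕ} →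
         Computableℕ f → Computableℕ g → Computableℕ (λ xs → f xs * g xs)
  _*ᶜ_ = apply₂ (recursion (λ n xs → n * head xs)
           (const 0)
           (var (suc (suc zero)) +ᶜ var (suc zero))
           (λ { _ (_ ∷ []) → refl }))

  predᶜ : ∀ {k} {f : Vec ℕ k → ℕ} → Computableℕ f → Computableℕ (pred ∘ f)
  predᶜ = apply₁ (recursion (λ n _ → pred n) (const 0) (var zero) (λ { _ [] → refl }))

  _∸ᶜ_ : ∀ {k} {f g : Vec ℕ k → ℕ} →
         Computableℕ f → Computableℕ g → Computableℕ (λ xs → f xs ∸ g xs)
  -- The recursion runs on the subtrahend, hence the swapped order `d c` at the end.
  c ∸ᶜ d = apply₂ (recursion (λ n xs → head xs ∸ n)
             (computable-≗ (λ { (_ ∷ []) → refl }) (var zero))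
             (predᶜ (var (suc zero)))
             (λ { n (x ∷ []) → pred[m∸n]≡m∸[1+n] x n })) d c

  ∑<ᶜ : ∀ {k} {b : Vec ℕ k → ℕ} {f : Vec ℕ (suc k) → ℕ} →
        Computableℕ b → Computableℕ f →
        Computableℕ (λ xs → ∑< (b xs) (λ i → f (i ∷ xs)))
  ∑<ᶜ {f = f} cb cf = substHead (recursion (λ n xs → ∑< n (λ i → f (i ∷ xs)))
    (const 0) (var (suc zero) +ᶜ skipSecond cf) (λ _ _ → refl)) cb

  -- The sign test for `codeℤ`, with values 0 and 1 so that it can be used as a factor.
  isEven : ℕ → ℕ
  isEven zero    = 1
  isEven (suc n) = 1 ∸ isEven n

  isEvenᶜ : ∀ {k} {f : Vec ℕ k → ℕ} → Computableℕ f → Computableℕ (isEven ∘ f)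
  isEvenᶜ = apply₁ (recursion (λ n _ → isEven n) (const 1) (const 1 ∸ᶜ var (suc zero))
              (λ { _ [] → refl }))

  isEven-2* : ∀ n → isEven (2 * n) ≡ 1
  isEven-2* zero    = refl
  isEven-2* (suc n) = begin
    1 ∸ isEven (n + suc (n + 0))  ≡⟨ cong (λ m → 1 ∸ isEven m) (+-suc n (n + 0)) ⟩
    1 ∸ (1 ∸ isEven (2 * n))      ≡⟨ cong (λ m → 1 ∸ (1 ∸ m)) (isEven-2* n) ⟩
    1                             ∎
    where open ≡-Reasoning

  -- Subtracting twice from 1 gives the sign function, so positivity is decided by arithmetic alone.
  positive-bit : ∀ n → bit (0 <ᵇ n) ≡ 1 ∸ (1 ∸ n)
  positive-bit zero    = refl
  positive-bit (suc n) = sym (cong (1 ∸_) (0∸n≡0 n))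

  positiveᶜ : ∀ {k} {f : Vec ℕ k → ℕ} → Computableℕ f → Computable (λ xs → 0 <ᵇ f xs)
  positiveᶜ {f = f} cf =
    computable-≗ (λ xs → sym (positive-bit (f xs))) (const 1 ∸ᶜ (const 1 ∸ᶜ cf))

  -- Finite sums.

  ∑<-mono-≤ : ∀ n {f g : ℕ → ℕ} → (∀ i → i < n → f i ≤ g i) → ∑< n f ≤ ∑< n g
  ∑<-mono-≤ zero    f≤g = z≤n
  ∑<-mono-≤ (suc n) f≤g =
    +-mono-≤ (∑<-mono-≤ n (λ i i<n → f≤g i (m<n⇒m<1+n i<n))) (f≤g n (n<1+n n))

  ∑<-const : ∀ n c → ∑< n (λ _ → c) ≡ c * n
  ∑<-const zero    c = sym (*-zeroʳ c)
  ∑<-const (suc n) c = begin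
    ∑< n (λ _ → c) + c ≡⟨ cong (_+ c) (∑<-const n c) ⟩
    c * n + c          ≡⟨ +-comm (c * n) c ⟩
    c + c * n          ≡⟨ *-suc c n ⟨
    c * suc n          ∎
    where open ≡-Reasoning

  ∑<-+ : ∀ n (f g : ℕ → ℕ) → ∑< n (λ i → f i + g i) ≡ ∑< n f + ∑< n g
  ∑<-+ zero    f g = refl
  ∑<-+ (suc n) f g = begin
    ∑< n (λ i → f i + g i) + (f n + g n) ≡⟨ cong (_+ (f n + g n)) (∑<-+ n f g) ⟩
    ∑< n f + ∑< n g + (f n + g n)        ≡⟨ interchange +-commutativeSemigroup (∑< n f) (∑< n g) (f n) (g n) ⟩
    ∑< n f + f n + (∑< n g + g n)        ∎
    where
    open ≡-Reasoning

  ∑<-cong : ∀ n {f g : ℕ → ℕ} → f ≗ g → ∑< n f ≡ ∑< n g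
  ∑<-cong zero    f≗g = refl
  ∑<-cong (suc n) f≗g = cong₂ _+_ (∑<-cong n f≗g) (f≗g n)

  ∑<-monoˡ-≤ : ∀ {m n} (f : ℕ → ℕ) → m ≤ n → ∑< m f ≤ ∑< n f
  ∑<-monoˡ-≤ {n = zero}  f z≤n = z≤n
  ∑<-monoˡ-≤ {n = suc n} f m≤n with m≤n⇒m<n∨m≡n m≤n
  ... | inj₁ (s≤s m≤n′) = ≤-trans (∑<-monoˡ-≤ f m≤n′) (m≤m+n _ _)
  ... | inj₂ refl       = ≤-refl

  term≤∑< : ∀ {n} (f : ℕ → ℕ) {i} → i < n → f i ≤ ∑< n f
  term≤∑< f {i} i<n = ≤-trans (m≤n+m (f i) (∑< i f)) (∑<-monoˡ-≤ f i<n)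

  ∑<-positive⁻ : ∀ n (f : ℕ → ℕ) → 0 < ∑< n f → ∃[ i ] (i < n × 0 < f i)
  ∑<-positive⁻ (suc n) f 0<∑ with f n in fn≡
  ... | suc _ = n , n<1+n n , subst (0 <_) (sym fn≡) z<s
  ... | zero  with ∑<-positive⁻ n f (subst (0 <_) (+-identityʳ _) 0<∑)
  ...   | i , i<n , 0<fi = i , m<n⇒m<1+n i<n , 0<fi

  ∑<-eventually-constant : ∀ (f : ℕ → ℕ) {s} → (∀ i → s ≤ i → f i ≡ 0) →
                           ∀ {t} → s ≤ t → ∑< t f ≡ ∑< s f
  ∑<-eventually-constant f {zero} f≡0 {zero} z≤n = refl
  ∑<-eventually-constant f {s} f≡0 {suc t} s≤t with m≤n⇒m<n∨m≡n s≤t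
  ... | inj₂ refl = refl
  ... | inj₁ (s≤s s≤t′) = begin
    ∑< t f + f t ≡⟨ cong (∑< t f +_) (f≡0 t s≤t′) ⟩
    ∑< t f + 0   ≡⟨ +-identityʳ _ ⟩
    ∑< t f       ≡⟨ ∑<-eventually-constant f f≡0 s≤t′ ⟩
    ∑< s f       ∎
    where open ≡-Reasoning

  length-filterᵇ-upTo : ∀ p n → length (filterᵇ p (upTo n)) ≡ ∑< n (bit ∘ p)
  length-filterᵇ-upTo p zero    = refl
  length-filterᵇ-upTo p (suc n) = begin
    length (filterᵇ p (upTo (suc n)))
      ≡⟨ cong (length ∘ filterᵇ p) (upTo-∷ʳ n) ⟨
    length (filterᵇ p (upTo n ∷ʳ n))
      ≡⟨ cong length (filter-++ (T? ∘ p) (upTo n) _) ⟩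
    length (filterᵇ p (upTo n) List.++ filterᵇ p (n ∷ []))
      ≡⟨ length-++ (filterᵇ p (upTo n)) ⟩
    length (filterᵇ p (upTo n)) + length (filterᵇ p (n ∷ []))
      ≡⟨ cong₂ _+_ (length-filterᵇ-upTo p n) last ⟩
    ∑< n (bit ∘ p) + bit (p n)
      ∎
    where
    open ≡-Reasoning
    last : length (filterᵇ p (n ∷ [])) ≡ bit (p n)
    last with p n
    ... | true  = refl
    ... | false = refl

  -- Counting by duplicate-free lists.

  Unique-lookup-injective : ∀ {A : Set} {ys : List A} → Unique ys →
    ∀ {i j} → List.lookup ys i ≡ List.lookup ys j → i ≡ j
  Unique-lookup-injective (_  ∷ _) {zero}  {zero}  _  = refl
  Unique-lookup-injective (x≢ ∷ _) {zero}  {suc j} eq =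
    contradiction eq (All.lookup x≢ (∈-lookup j))
  Unique-lookup-injective (x≢ ∷ _) {suc i} {zero}  eq =
    contradiction (sym eq) (All.lookup x≢ (∈-lookup i))
  Unique-lookup-injective (_  ∷ u) {suc i} {suc j} eq =
    cong suc (Unique-lookup-injective u eq)

  -- Pigeonhole: sending each position in `ys` to a position of the same element in `xs` is an
  -- injection between finite sets.
  Unique⊆⇒length≤ : ∀ {A : Set} {ys xs : List A} →
                    Unique ys → (∀ {y} → y ∈ ys → y ∈ xs) → length ys ≤ length xs
  Unique⊆⇒length≤ {ys = ys} uniq sub = Fin.injective⇒≤ {f = λ i → index (sub (∈-lookup {xs = ys} i))}
    (λ eq → Unique-lookup-injective uniq (index-injective (setoid _) _ _ eq))

  -- Turns a bound in the form of `AtMost` into a bound on counts: the stages below `n` with `p`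
  -- true form a duplicate-free list inside `xs`.
  ∑<-bit≤length : ∀ p {xs} → (∀ s → p s ≡ true → s ∈ xs) → ∀ n → ∑< n (bit ∘ p) ≤ length xs
  ∑<-bit≤length p p⊆xs n = subst (_≤ _) (length-filterᵇ-upTo p n)
    (Unique⊆⇒length≤ (Unique.filter⁺ (T? ∘ p) (Unique.upTo⁺ n))
      (λ {s} s∈ → p⊆xs s (Equivalence.to T-≡ (proj₂ (∈-filter⁻ (T? ∘ p) {xs = upTo n} s∈)))))

  -- Conjunction and order in truncated arithmetic.

  *-positive⁺ : ∀ {m n} → 0 < m → 0 < n → 0 < m * n
  *-positive⁺ (s≤s _) (s≤s _) = z<s

  *-positive⁻ : ∀ m {n} → 0 < m * n → 0 < m × 0 < n
  *-positive⁻ (suc m) {suc n} _ = z<s , z<s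
  *-positive⁻ (suc m) {zero}  0<0 = contradiction (subst (0 <_) (*-zeroʳ m) 0<0) (λ ())

  1∸-positive⁺ : ∀ {m n} → m ≤ n → 0 < 1 ∸ (m ∸ n)
  1∸-positive⁺ m≤n rewrite m≤n⇒m∸n≡0 m≤n = z<s

  1∸-positive⁻ : ∀ {m n} → 0 < 1 ∸ (m ∸ n) → m ≤ n
  1∸-positive⁻ {m} {n} 0<1∸ with m ∸ n in eq
  ... | zero  = m∸n≡0⇒m≤n eq
  ... | suc k = contradiction (subst (0 <_) (0∸n≡0 k) 0<1∸) (λ ())

-- Rational arithmetic and codes of rationals.

module _ where

  open import Data.Integer as ℤ using (+_; -[1+_])
  import Data.Integer.Properties as ℤ
  open import Data.Rational hiding (_≃_)
  open import Data.Rational.Properties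
  open import Data.Rational.Solver using (module +-*-Solver)
  open +-*-Solver using (solve; con; _:=_; _:+_; _:*_; _:-_; :-_)
  open Equivalence using (to; from)

  -- `_/_` reduces to lowest terms, so the cross-multiplication is done on unnormalised rationals,
  -- which keep the given numerators and denominators.
  /-≤-/⁻ : ∀ i d j e → i / suc d ≤ j / suc e → i ℤ.* + suc e ℤ.≤ j ℤ.* + suc d
  /-≤-/⁻ i d j e i/d≤j/e = ℚᵘ.drop-*≤*
    (ℚᵘ.≤-respˡ-≃ (toℚᵘ-fromℚᵘ (ℚᵘ.mkℚᵘ i d))
      (ℚᵘ.≤-respʳ-≃ (toℚᵘ-fromℚᵘ (ℚᵘ.mkℚᵘ j e)) (toℚᵘ-mono-≤ i/d≤j/e)))

  /-≤-/⁺ : ∀ i d j e → i ℤ.* + suc e ℤ.≤ j ℤ.* + suc d → i / suc d ≤ j / suc e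
  /-≤-/⁺ i d j e le = toℚᵘ-cancel-≤
    (ℚᵘ.≤-respˡ-≃ (ℚᵘ.≃-sym (toℚᵘ-fromℚᵘ (ℚᵘ.mkℚᵘ i d)))
      (ℚᵘ.≤-respʳ-≃ (ℚᵘ.≃-sym (toℚᵘ-fromℚᵘ (ℚᵘ.mkℚᵘ j e))) (ℚᵘ.*≤* le)))

  ℕ/-≤-/⁻ : ∀ a d b e → + a / suc d ≤ + b / suc e → a ℕ.* suc e ℕ.≤ b ℕ.* suc d
  ℕ/-≤-/⁻ a d b e le = ℤ.drop‿+≤+
    (subst₂ ℤ._≤_ (sym (ℤ.pos-* a (suc e))) (sym (ℤ.pos-* b (suc d))) (/-≤-/⁻ (+ a) d (+ b) e le))

  ℕ/-≤-/⁺ : ∀ a d b e → a ℕ.* suc e ℕ.≤ b ℕ.* suc d → + a / suc d ≤ + b / suc e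
  ℕ/-≤-/⁺ a d b e le = /-≤-/⁺ (+ a) d (+ b) e
    (subst₂ ℤ._≤_ (ℤ.pos-* a (suc e)) (ℤ.pos-* b (suc d)) (ℤ.+≤+ le))

  /-distrib-+ : ∀ i j d → (i ℤ.+ j) / suc d ≡ i / suc d + j / suc d
  /-distrib-+ i j d = toℚᵘ-injective (begin-equality
    toℚᵘ ((i ℤ.+ j) / suc d)               ≃⟨ toℚᵘ-fromℚᵘ (ℚᵘ.mkℚᵘ (i ℤ.+ j) d) ⟩
    ℚᵘ.mkℚᵘ (i ℤ.+ j) d                    ≃⟨ ℚᵘ.*≡* common-denominator ⟩
    ℚᵘ.mkℚᵘ i d ℚᵘ.+ ℚᵘ.mkℚᵘ j d           ≃⟨ ℚᵘ.+-cong (toℚᵘ-fromℚᵘ (ℚᵘ.mkℚᵘ i d))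
                                                         (toℚᵘ-fromℚᵘ (ℚᵘ.mkℚᵘ j d)) ⟨
    toℚᵘ (i / suc d) ℚᵘ.+ toℚᵘ (j / suc d) ≃⟨ toℚᵘ-homo-+ (i / suc d) (j / suc d) ⟨
    toℚᵘ (i / suc d + j / suc d)           ∎)
    where
    open ℚᵘ.≤-Reasoning
    D = + suc d
    common-denominator : (i ℤ.+ j) ℤ.* (D ℤ.* D) ≡ (i ℤ.* D ℤ.+ j ℤ.* D) ℤ.* D
    common-denominator = trans (sym (ℤ.*-assoc (i ℤ.+ j) D D)) (cong (ℤ._* D) (ℤ.*-distribʳ-+ D i j))

  unitFraction : ℕ → ℚ
  unitFraction k = + 1 / suc k

  archimedean : ∀ ε → 0ℚ < ε → ∃[ N ] (∀ k → N ℕ.≤ k → unitFraction k ≤ ε)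
  archimedean ε@(mkℚ (+ zero)  d c) (*<* (ℤ.+<+ ()))
  archimedean ε@(mkℚ -[1+ a ]  d c) (*<* ())
  -- The denominator gives the bound: for `k ≥ d`, 1/(k+1) ≤ 1/(d+1) ≤ (a+1)/(d+1).
  archimedean ε@(mkℚ (+ suc a) d c) _ = d , λ k d≤k →
    subst (unitFraction k ≤_) (↥p/↧p≡p ε)
      (ℕ/-≤-/⁺ 1 k (suc a) d (ℕ.*-mono-≤ (ℕ.s≤s (ℕ.z≤n {a})) (ℕ.s≤s d≤k)))

  p<q+r⇒p-q<r : ∀ {p} q r → p < q + r → p - q < r
  p<q+r⇒p-q<r {p} q r p<q+r = subst (p - q <_)
    (solve 2 (λ q r → (q :+ r) :- q := r) refl q r) (+-monoˡ-< (- q) p<q+r)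

  p≤q+r⇒p-q≤r : ∀ {p} q r → p ≤ q + r → p - q ≤ r
  p≤q+r⇒p-q≤r {p} q r p≤q+r = subst (p - q ≤_)
    (solve 2 (λ q r → (q :+ r) :- q := r) refl q r) (+-monoˡ-≤ (- q) p≤q+r)

  p-q<r⇒p<q+r : ∀ p q {r} → p - q < r → p < q + r
  p-q<r⇒p<q+r p q {r} p-q<r = subst (_< q + r)
    (solve 2 (λ p q → q :+ (p :- q) := p) refl p q) (+-monoʳ-< q p-q<r)

  p<r+q⇒p-q<r : ∀ {p r} q → p < r + q → p - q < r
  p<r+q⇒p-q<r {p} {r} q p<r+q = p<q+r⇒p-q<r q r (subst (p <_) (+-comm r q) p<r+q)

  p<p+q : ∀ p {q} → 0ℚ < q → p < p + q
  p<p+q p {q} 0<q = subst (_< p + q) (+-identityʳ p) (+-monoʳ-< p 0<q)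

  ½-positive : ∀ {ε} → 0ℚ < ε → 0ℚ < ½ * ε
  ½-positive = *-monoʳ-<-pos ½

  ∣p-q∣<r : ∀ p q {r} → p < q + r → q < p + r → ∣ p - q ∣ < r
  ∣p-q∣<r p q {r} p<q+r q<p+r with ∣p∣≡p∨∣p∣≡-p (p - q)
  ... | inj₁ eq = subst (_< r) (sym eq) (p<q+r⇒p-q<r q r p<q+r)
  ... | inj₂ eq = subst (_< r) (sym (trans eq (solve 2 (λ p q → :- (p :- q) := q :- p) refl p q)))
                    (p<q+r⇒p-q<r p r q<p+r)

  ∣p-q∣<r⇒p<q+r : ∀ p q {r} → ∣ p - q ∣ < r → p < q + r
  ∣p-q∣<r⇒p<q+r p q {r} h = p-q<r⇒p<q+r p q (≤-<-trans (p≤∣p∣ (p - q)) h)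
    where
    p≤∣p∣ : ∀ p → p ≤ ∣ p ∣
    p≤∣p∣ p with ≤-total 0ℚ p
    ... | inj₁ 0≤p = ≤-reflexive (sym (0≤p⇒∣p∣≡p 0≤p))
    ... | inj₂ p≤0 = ≤-trans p≤0 (0≤∣p∣ p)

  -- Allows a single rational to be excluded from a cut by comparing codes.
  codeℚ-injective : ∀ {p q} → codeℚ p ≡ codeℚ q → p ≡ q
  codeℚ-injective {p} {q} eq = begin
    p              ≡⟨ ↥p/↧p≡p p ⟨
    ↥ p / ↧ₙ p     ≡⟨ /-cong (codeℤ-injective (↥ p) (↥ q) (proj₁ (∷-injective eq)))
                            (proj₁ (∷-injective (proj₂ (∷-injective eq)))) ⟩
    ↥ q / ↧ₙ q     ≡⟨ ↥p/↧p≡p q ⟩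
    q              ∎
    where
    open ≡-Reasoning
    codeℤ-injective : ∀ i j → codeℤ i ≡ codeℤ j → i ≡ j
    codeℤ-injective (+ m)    (+ n)    eq = cong +_ (ℕ.*-cancelˡ-≡ m n 2 eq)
    codeℤ-injective -[1+ m ] -[1+ n ] eq = cong -[1+_] (ℕ.*-cancelˡ-≡ m n 2 (ℕ.suc-injective eq))
    codeℤ-injective (+ m)    -[1+ n ] eq = contradiction eq (ℕ.even≢odd m n)
    codeℤ-injective -[1+ m ] (+ n)    eq = contradiction (sym eq) (ℕ.even≢odd n m)

  -- Upper limits of bounded sequences.

  infix 4 _≤∞_

  -- Agrees with being below the upper limit, except possibly at the upper limit itself, and has the
  -- quantifier prefix of a Π⁰₂ condition.
  _≤∞_ : ℚ → (ℕ → ℚ) → Set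
  q ≤∞ p = ∀ k → ∃[ m ] (k ℕ.≤ m × q ≤ p m)

  ≤∞-lower : ∀ {p q r} → q ≤ r → r ≤∞ p → q ≤∞ p
  ≤∞-lower q≤r r≤∞p k with r≤∞p k
  ... | m , k≤m , r≤pm = m , k≤m , ≤-trans q≤r r≤pm

  ≤∞-separates : ∀ {p q r} → q ≤∞ p → ¬ r ≤∞ p → q < r
  ≤∞-separates q≤∞p r≰∞p = ≰⇒> (λ r≤q → r≰∞p (≤∞-lower r≤q q≤∞p))

  -- An inequality that holds only eventually suffices, since asking for an index beyond `k ⊔ M`
  -- discards the exceptions.
  ≤∞-shift : ∀ {p p′} M z → (∀ m → M ℕ.≤ m → p m ≤ z + p′ m) →
             ∀ {q} → q ≤∞ p → q - z ≤∞ p′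
  ≤∞-shift M z p≤z+p′ q≤∞p k with q≤∞p (k ℕ.⊔ M)
  ... | m , k⊔M≤m , q≤pm = m , ℕ.m⊔n≤o⇒m≤o k M k⊔M≤m ,
    p≤q+r⇒p-q≤r z _ (≤-trans q≤pm (p≤z+p′ m (ℕ.m⊔n≤o⇒n≤o k M k⊔M≤m)))

  -- A discrete intermediate value argument, searching downwards from `n`. It locates the upper
  -- limit on a grid.
  crossing : {P : ℕ → Set} → (∀ j → Dec (P j)) → P 0 → ∀ n → ¬ P n → ∃[ j ] (P j × ¬ P (suc j))
  crossing P? P0 zero    ¬P0 = contradiction P0 ¬P0
  crossing P? P0 (suc n) ¬Pn with P? n
  ... | yes Pn  = n , Pn , ¬Pn
  ... | no ¬Pn′ = crossing P? P0 n ¬Pn′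

  module UpperLimit
    (em : ExcludedMiddle 0ℓ) (p : ℕ → ℚ) (C : ℕ) (0≤p : ∀ m → 0ℚ ≤ p m) (p≤C : ∀ m → p m ≤ + C / 1)
    where

    -- Excluded middle decides `≤∞ p` at each multiple of 1/(k+1). It holds at 0 because `p` is
    -- nonnegative, and fails far enough to the right because `p` is bounded.
    approx : ∀ k → ∃[ j ] (+ j / suc k ≤∞ p × ¬ + suc j / suc k ≤∞ p)
    approx k = crossing {λ j → + j / suc k ≤∞ p} (λ _ → em)
      (λ m → m , ℕ.≤-refl , subst (_≤ p m) (sym (0/n≡0 (suc k))) (0≤p m))
      -- At this index the grid point is `C + 1`, which exceeds every `p m`.
      (suc C ℕ.* suc k) tooLarge
      where
      tooLarge : ¬ + (suc C ℕ.* suc k) / suc k ≤∞ p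
      tooLarge ≤∞p with ≤∞p 0
      ... | m , _ , ≤pm = ℕ.<⇒≱ (ℕ.n<1+n C) (ℕ.*-cancelʳ-≤ (suc C) C (suc k)
        (subst (ℕ._≤ C ℕ.* suc k) (ℕ.*-identityʳ _)
          (ℕ/-≤-/⁻ (suc C ℕ.* suc k) k C 0 (≤-trans ≤pm (p≤C m)))))

    -- The upper limit lies between this grid point and the next, so the error is at most 1/(k+1).
    lim : ℕ → ℚ
    lim k = + proj₁ (approx k) / suc k

    lim≤∞ : ∀ k → lim k ≤∞ p
    lim≤∞ k = proj₁ (proj₂ (approx k))

    lim+≰∞ : ∀ k → ¬ lim k + unitFraction k ≤∞ p
    lim+≰∞ k = subst (λ q → ¬ q ≤∞ p) eq (proj₂ (proj₂ (approx k)))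
      where
      j = proj₁ (approx k)
      eq : + suc j / suc k ≡ lim k + unitFraction k
      eq = trans (cong (λ i → + i / suc k) (ℕ.+-comm 1 j)) (/-distrib-+ (+ j) (+ 1) k)

    ≤∞⇒<lim+ : ∀ {q} k → q ≤∞ p → q < lim k + unitFraction k
    ≤∞⇒<lim+ k q≤∞p = ≤∞-separates q≤∞p (lim+≰∞ k)

    limsup : ℝ
    limsup = mkℝ lim λ ε 0<ε →
      let N , small = archimedean ε 0<ε
          close : ∀ m n → N ℕ.≤ n → lim m < lim n + ε
          -- `lim m` is itself at most infinitely many terms of `p`, hence below the right end of
          -- the grid cell found at `n`.
          close m n N≤n = <-≤-trans (≤∞⇒<lim+ n (lim≤∞ m)) (+-monoʳ-≤ (lim n) (small n N≤n))
      in N , λ m n N≤m N≤n → ∣p-q∣<r (lim m) (lim n) (close m n N≤n) (close n m N≤m)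

    -- The margin `ε` contained in `<ᴿ` leaves room for `q + ε`, which is still at most `lim N`.
    <limsup⇒ : ∀ {q} → fromℚ q <ᴿ limsup → ∃[ q′ ] (q < q′ × q′ ≤∞ p)
    <limsup⇒ {q} (ε , 0<ε , N , q+ε≤) =
      q + ε , p<p+q q 0<ε , ≤∞-lower (q+ε≤ N ℕ.≤-refl) (lim≤∞ N)

    ⇒<limsup : ∀ {q q′} → q < q′ → q′ ≤∞ p → fromℚ q <ᴿ limsup
    -- Half of the gap between `q` and `q′` becomes the margin; the other half absorbs the grid
    -- error 1/(n+1).
    ⇒<limsup {q} {q′} q<q′ q′≤∞p = ½ * δ , 0<½δ , N , λ n N≤n → <⇒≤ (begin-strict
      q + ½ * δ                           ≡⟨ split q q′ ⟩
      q′ - ½ * δ                          ≤⟨ +-monoʳ-≤ q′ (neg-antimono-≤ (small n N≤n)) ⟩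
      q′ - unitFraction n                 <⟨ p<r+q⇒p-q<r (unitFraction n) (≤∞⇒<lim+ n q′≤∞p) ⟩
      lim n                               ∎)
      where
      open ≤-Reasoning
      δ = q′ - q
      0<½δ : 0ℚ < ½ * δ
      0<½δ = ½-positive (subst (_< δ) (+-inverseʳ q) (+-monoˡ-< (- q) q<q′))
      N = proj₁ (archimedean (½ * δ) 0<½δ)
      small = proj₂ (archimedean (½ * δ) 0<½δ)
      split : ∀ q q′ → q + ½ * (q′ - q) ≡ q′ - ½ * (q′ - q)
      split = solve 2 (λ q q′ → q :+ con ½ :* (q′ :- q) := q′ :- con ½ :* (q′ :- q)) refl

    IsGreatest≤∞ : ℚ → Set
    IsGreatest≤∞ q₀ = q₀ ≤∞ p × (∀ q → q ≤∞ p → q ≤ q₀)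

    <limsup⇒≤∞ : ∀ {q} → fromℚ q <ᴿ limsup → q ≤∞ p
    <limsup⇒≤∞ q<r = let _ , q<q′ , q′≤∞p = <limsup⇒ q<r in ≤∞-lower (<⇒≤ q<q′) q′≤∞p

    <limsup⇒<greatest : ∀ {q q₀} → IsGreatest≤∞ q₀ → fromℚ q <ᴿ limsup → q < q₀
    <limsup⇒<greatest (_ , max) q<r =
      let q′ , q<q′ , q′≤∞p = <limsup⇒ q<r in <-≤-trans q<q′ (max q′ q′≤∞p)

    -- Were `q` not below `limsup`, then by `⇒<limsup` nothing larger than `q` could satisfy `≤∞ p`,
    -- and `q` would be greatest.
    ≤∞-nongreatest⇒<limsup : ∀ {q} → ¬ IsGreatest≤∞ q → q ≤∞ p → fromℚ q <ᴿ limsup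
    ≤∞-nongreatest⇒<limsup {q} ¬max q≤∞p = em⇒dne em {fromℚ q <ᴿ limsup}
      λ q≮r → ¬max (q≤∞p , λ q′ q′≤∞p → ≮⇒≥ λ q<q′ → q≮r (⇒<limsup q<q′ q′≤∞p))

    -- The cut { q | q < limsup } is { q | q ≤∞ p } without its greatest element, if there
    -- is one; (0, 0) codes no rational.
    exceptional-code : Σ[ c ∈ Vec ℕ 2 ] (∀ q → (fromℚ q <ᴿ limsup) ⇔ (codeℚ q ≢ c × q ≤∞ p))
    exceptional-code = byCases em
      where
      byCases : Dec (∃[ q₀ ] IsGreatest≤∞ q₀) →
                Σ[ c ∈ Vec ℕ 2 ] (∀ q → (fromℚ q <ᴿ limsup) ⇔ (codeℚ q ≢ c × q ≤∞ p))
      byCases (yes (q₀ , greatest)) = codeℚ q₀ , λ q → mk⇔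
        (λ q<r → (λ eq → <-irrefl (codeℚ-injective {q} {q₀} eq) (<limsup⇒<greatest greatest q<r)) ,
                 <limsup⇒≤∞ q<r)
        (λ (q≢q₀ , q≤∞p) → ≤∞-nongreatest⇒<limsup
          (λ (_ , max) → q≢q₀ (cong codeℚ (≤-antisym (proj₂ greatest q q≤∞p) (max q₀ (proj₁ greatest)))))
          q≤∞p)
      byCases (no ¬max) = 0 ∷ 0 ∷ [] , λ q → mk⇔
        (λ q<r → (λ ()) , <limsup⇒≤∞ q<r)
        (λ (_ , q≤∞p) → ≤∞-nongreatest⇒<limsup (λ max → ¬max (q , max)) q≤∞p)

  -- Averages, and arithmetical tests on codes of rationals.

  0≤/ : ∀ v m → 0ℚ ≤ + v / suc m
  0≤/ v m = nonNegative⁻¹ (+ v / suc m) {{normalize-nonNeg v (suc m)}}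

  -- Even codes 2n are those of the nonnegative numerators n; for a negative
  -- numerator the left-hand side is 0.
  ≤/⇔code : ∀ q v m → q ≤ + v / suc m ⇔
    (codeℤ (↥ q) ℕ.* isEven (codeℤ (↥ q)) ℕ.* suc m ℕ.≤ 2 ℕ.* (v ℕ.* ↧ₙ q))
  ≤/⇔code q@(mkℚ -[1+ n ] d _) v m = mk⇔
    (λ _ → subst (ℕ._≤ 2 ℕ.* (v ℕ.* suc d)) (sym lhs≡0) ℕ.z≤n)
    (λ _ → ≤-trans (nonPositive⁻¹ q) (0≤/ v m))
    where
    c = suc (2 ℕ.* n)
    lhs≡0 : c ℕ.* isEven c ℕ.* suc m ≡ 0
    lhs≡0 = cong (ℕ._* suc m)
      (trans (cong (λ b → c ℕ.* (1 ℕ.∸ b)) (isEven-2* n)) (ℕ.*-zeroʳ c))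
  ≤/⇔code q@(mkℚ (+ n) d _) v m = mk⇔
    (λ q≤ → subst (ℕ._≤ 2 ℕ.* (v ℕ.* suc d)) (sym lhs≡)
      (ℕ.*-monoʳ-≤ 2 (ℕ/-≤-/⁻ n d v m (subst (_≤ + v / suc m) (sym (↥p/↧p≡p q)) q≤))))
    (λ le → subst (_≤ + v / suc m) (↥p/↧p≡p q)
      (ℕ/-≤-/⁺ n d v m (ℕ.*-cancelˡ-≤ 2 (subst (ℕ._≤ 2 ℕ.* (v ℕ.* suc d)) lhs≡ le))))
    where
    open ≡-Reasoning
    lhs≡ : 2 ℕ.* n ℕ.* isEven (2 ℕ.* n) ℕ.* suc m ≡ 2 ℕ.* (n ℕ.* suc m)
    lhs≡ = begin
      2 ℕ.* n ℕ.* isEven (2 ℕ.* n) ℕ.* suc m ≡⟨ cong (λ b → 2 ℕ.* n ℕ.* b ℕ.* suc m) (isEven-2* n) ⟩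
      2 ℕ.* n ℕ.* 1 ℕ.* suc m                ≡⟨ cong (ℕ._* suc m) (ℕ.*-identityʳ (2 ℕ.* n)) ⟩
      2 ℕ.* n ℕ.* suc m                      ≡⟨ ℕ.*-assoc 2 n (suc m) ⟩
      2 ℕ.* (n ℕ.* suc m)                    ∎

  -- The shift to `suc m` matches the indexing in `HasDensity`.
  average : (ℕ → ℕ) → ℕ → ℚ
  average w m = + ∑< (suc m) w / suc m

  average≤ : ∀ {w n} → (∀ x → w x ℕ.≤ n) → ∀ m → average w m ≤ + n / 1
  average≤ {w} {n} w≤n m = ℕ/-≤-/⁺ (∑< (suc m) w) m n 0
    (subst₂ ℕ._≤_ (sym (ℕ.*-identityʳ (∑< (suc m) w))) (∑<-const (suc m) n)
      (∑<-mono-≤ (suc m) (λ i _ → w≤n i)))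

  /-monoˡ-≤ : ∀ {v v′} m → v ℕ.≤ v′ → + v / suc m ≤ + v′ / suc m
  /-monoˡ-≤ {v} {v′} m v≤v′ = ℕ/-≤-/⁺ v m v′ m (ℕ.*-monoˡ-≤ (suc m) v≤v′)

  0<ᵇ⇒0< : ∀ {n} → (0 ℕ.<ᵇ n) ≡ true → 0 ℕ.< n
  0<ᵇ⇒0< {suc n} _ = ℕ.z<s

  0<⇒0<ᵇ : ∀ {n} → 0 ℕ.< n → (0 ℕ.<ᵇ n) ≡ true
  0<⇒0<ᵇ {suc n} _ = refl

  -- The ℓ¹ distance between the pairs `(c, e)` and `(c₁, c₂)`, each absolute value being a sum of
  -- two truncated differences. It tests computably that a code is not the exceptional one.
  differences : (c₁ c₂ c e : ℕ) → ℕ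
  differences c₁ c₂ c e = (c ℕ.∸ c₁ ℕ.+ (c₁ ℕ.∸ c)) ℕ.+ (e ℕ.∸ c₂ ℕ.+ (c₂ ℕ.∸ e))

  differences-positive : ∀ c₁ c₂ c e →
    0 ℕ.< differences c₁ c₂ c e ⇔ c Vec.∷ e ∷ [] ≢ c₁ ∷ c₂ ∷ []
  differences-positive c₁ c₂ c e = mk⇔
    (λ { 0<d refl → ℕ.<-irrefl (sym (cong₂ ℕ._+_ (∣n-n∣ c) (∣n-n∣ e))) 0<d })
    (λ ≢ → ℕ.n≢0⇒n>0 (λ d≡0 → ≢ (cong₂ (λ x y → x ∷ y ∷ [])
       (equal c c₁ (ℕ.m+n≡0⇒m≡0 _ d≡0)) (equal e c₂ (ℕ.m+n≡0⇒n≡0 (c ℕ.∸ c₁ ℕ.+ (c₁ ℕ.∸ c)) d≡0)))))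
    where
    ∣n-n∣ : ∀ n → (n ℕ.∸ n) ℕ.+ (n ℕ.∸ n) ≡ 0
    ∣n-n∣ n = cong₂ ℕ._+_ (ℕ.n∸n≡0 n) (ℕ.n∸n≡0 n)
    equal : ∀ m n → (m ℕ.∸ n) ℕ.+ (n ℕ.∸ m) ≡ 0 → m ≡ n
    equal m n eq = ℕ.≤-antisym (ℕ.m∸n≡0⇒m≤n (ℕ.m+n≡0⇒m≡0 _ eq))
      (ℕ.m∸n≡0⇒m≤n (ℕ.m+n≡0⇒n≡0 (m ℕ.∸ n) eq))

  -- Upper limits of averaged event counts are left-Π⁰₂.

  module FiniteCounts
    (em : ExcludedMiddle 0ℓ)
    (h : ℕ → ℕ → Bool) (computable-h : Computable (onVec₂ h))
    (n : ℕ) (count≤n : ∀ x t → ∑< t (bit ∘ h x) ℕ.≤ n)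
    (settles : ∀ x → ∃[ s₀ ] (∀ s → s₀ ℕ.≤ s → h x s ≡ false))
    where

    settled : ℕ → ℕ
    settled x = proj₁ (settles x)

    -- In the application `h x s` marks a change at stage `s`, of the kind 0 → 1 or of the kind 1 →
    -- 0. `settled` carries no computability, so these totals are only approached from below, by the
    -- computable counts up to a stage `t`.
    total : ℕ → ℕ
    total x = ∑< (settled x) (bit ∘ h x)

    count≡total : ∀ x {t} → settled x ℕ.≤ t → ∑< t (bit ∘ h x) ≡ total x
    count≡total x = ∑<-eventually-constant (bit ∘ h x) (λ s s₀≤s → cong bit (proj₂ (settles x) s s₀≤s))

    count≤total : ∀ x t → ∑< t (bit ∘ h x) ℕ.≤ total x
    count≤total x t with ℕ.≤-total (settled x) t
    ... | inj₁ s₀≤t = ℕ.≤-reflexive (count≡total x s₀≤t)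
    ... | inj₂ t≤s₀ = ∑<-monoˡ-≤ (bit ∘ h x) t≤s₀

    countBelow : ℕ → ℕ → ℕ
    countBelow m t = ∑< m (λ x → ∑< t (bit ∘ h x))

    countBelow≤ : ∀ m t → countBelow m t ℕ.≤ ∑< m total
    countBelow≤ m t = ∑<-mono-≤ m (λ x _ → count≤total x t)

    -- The sum of the settling stages is at least each of them, which makes it a common settling
    -- stage for all `x < m`.
    countBelow≥ : ∀ m {t} → ∑< m settled ℕ.≤ t → ∑< m total ℕ.≤ countBelow m t
    countBelow≥ m {t} s≤t = ∑<-mono-≤ m (λ x x<m →
      ℕ.≤-reflexive (sym (count≡total x (ℕ.≤-trans (term≤∑< settled x<m) s≤t))))

    0≤average : ∀ m → 0ℚ ≤ average total m
    0≤average m = 0≤/ (∑< (suc m) total) m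

    average≤n : ∀ m → average total m ≤ + n / 1
    average≤n = average≤ (λ x → count≤n x (settled x))

    open UpperLimit em (average total) n 0≤average average≤n public

    module _ (c₁ c₂ : ℕ) where

      -- The pair `(c, e)` is the code of a rational. The number `b` both bounds the search for `m`
      -- and is the stage at which events are counted, so one existential quantifier covers both.
      witnesses : ℕ → ℕ → ℕ → ℕ → ℕ
      witnesses a b c e = ∑< b λ m →
        (1 ℕ.∸ (a ℕ.∸ m)) ℕ.*
        (1 ℕ.∸ (c ℕ.* isEven c ℕ.* suc m ℕ.∸ 2 ℕ.* (countBelow (suc m) b ℕ.* e)))

      test : Vec ℕ 4 → ℕ
      test xs = differences c₁ c₂ (lookup xs (suc (suc zero))) (lookup xs (suc (suc (suc zero)))) ℕ.*
        witnesses (lookup xs zero) (lookup xs (suc zero))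
                  (lookup xs (suc (suc zero))) (lookup xs (suc (suc (suc zero))))

      testᶜ : Computableℕ test
      testᶜ = (((c ∸ᶜ const c₁) +ᶜ (const c₁ ∸ᶜ c)) +ᶜ ((e ∸ᶜ const c₂) +ᶜ (const c₂ ∸ᶜ e)))
        *ᶜ ∑<ᶜ b
             ((const 1 ∸ᶜ (a′ ∸ᶜ m′))
              *ᶜ (const 1 ∸ᶜ ((c′ *ᶜ isEvenᶜ c′) *ᶜ sucᶜ m′
                               ∸ᶜ const 2 *ᶜ (∑<ᶜ (sucᶜ m′) (∑<ᶜ b″ hᶜ) *ᶜ e′))))
        where
        -- One prime: under the binder of m; two: under those of m and x.
        b = var (suc zero)
        c = var (suc (suc zero))
        e = var (suc (suc (suc zero)))
        m′ = var zero
        a′ = var (suc zero)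
        c′ = var (suc (suc (suc zero)))
        e′ = var (suc (suc (suc (suc zero))))
        b″ = var (suc (suc (suc zero)))
        hᶜ : Computableℕ {7} (λ xs → bit (h (lookup xs (suc zero)) (lookup xs zero)))
        hᶜ = apply₂ {f = bit ∘ onVec₂ h} computable-h (var (suc zero)) (var zero)

      -- In `test` a product acts as a conjunction, the sum as a bounded existential quantifier, and
      -- `1 ∸ (x ∸ y)` as the indicator of `x ≤ y`.
      test⇔ : ∀ a b q → 0 ℕ.< test (a ∷ b ∷ codeℚ q) ⇔
        (codeℚ q ≢ c₁ ∷ c₂ ∷ [] ×
         ∃[ m ] (m ℕ.< b × a ℕ.≤ m × q ≤ + countBelow (suc m) b / suc m))
      test⇔ a b q = mk⇔
        (λ 0<t → case *-positive⁻ (differences c₁ c₂ (codeℤ (↥ q)) (↧ₙ q)) 0<t of λ (0<d , 0<w) →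
           to (differences-positive c₁ c₂ _ _) 0<d ,
           (case ∑<-positive⁻ b _ 0<w of λ (m , m<b , 0<f) →
            case *-positive⁻ (1 ℕ.∸ (a ℕ.∸ m)) 0<f of λ (0<a , 0<q) →
              m , m<b , 1∸-positive⁻ 0<a , from (≤/⇔code q (countBelow (suc m) b) m) (1∸-positive⁻ 0<q)))
        (λ (≢ , m , m<b , a≤m , q≤) → *-positive⁺ (from (differences-positive c₁ c₂ _ _) ≢)
           (ℕ.<-≤-trans
             (*-positive⁺ (1∸-positive⁺ {a} {m} a≤m)
                          (1∸-positive⁺ (to (≤/⇔code q (countBelow (suc m) b) m) q≤)))
             (term≤∑< _ m<b)))

    limsup-LeftΠ⁰₂ : LeftΠ⁰₂ limsup
    limsup-LeftΠ⁰₂ = fromCode exceptional-code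
      where
      fromCode : Σ[ c ∈ Vec ℕ 2 ] (∀ q → (fromℚ q <ᴿ limsup) ⇔ (codeℚ q ≢ c × q ≤∞ average total)) →
                 LeftΠ⁰₂ limsup
      fromCode (c₁ ∷ c₂ ∷ [] , cut) =
        (λ xs → 0 ℕ.<ᵇ test c₁ c₂ xs) , positiveᶜ (testᶜ c₁ c₂) , λ q → mk⇔ (witness q) (below q)
        where
        witness : ∀ q → fromℚ q <ᴿ limsup → ∀ a → ∃[ b ] (0 ℕ.<ᵇ test c₁ c₂ (a ∷ b ∷ codeℚ q)) ≡ true
        witness q q<r a =
          case to (cut q) q<r of λ (≢ , q≤∞) → case q≤∞ a of λ (m , a≤m , q≤) →
          -- `b` has to exceed `m` and to be a stage by which all counts at arguments up to `m` have
          -- settled.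
          let S = ∑< (suc m) settled
              b = suc m ℕ.⊔ S
          in b , 0<⇒0<ᵇ (from (test⇔ c₁ c₂ a b q) (≢ , m , ℕ.m≤m⊔n (suc m) S , a≤m ,
                   ≤-trans q≤ (/-monoˡ-≤ m (countBelow≥ (suc m) (ℕ.m≤n⊔m (suc m) S)))))

        below : ∀ q → (∀ a → ∃[ b ] (0 ℕ.<ᵇ test c₁ c₂ (a ∷ b ∷ codeℚ q)) ≡ true) → fromℚ q <ᴿ limsup
        below q R = from (cut q)
          -- The condition on the code does not involve `a`, so the instance `a = 0` yields it.
          ( proj₁ (to (test⇔ c₁ c₂ 0 (proj₁ (R 0)) q) (0<ᵇ⇒0< (proj₂ (R 0))))
          -- Counts at a finite stage never exceed the totals, so an `m` found at any stage is a
          -- genuine witness.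
          , λ a → case to (test⇔ c₁ c₂ a (proj₁ (R a)) q) (0<ᵇ⇒0< (proj₂ (R a))) of
              λ (_ , m , _ , a≤m , q≤) →
                m , a≤m , ≤-trans q≤ (/-monoˡ-≤ m (countBelow≤ (suc m) (proj₁ (R a)))))

  -- Limits as differences of upper limits.

  ⟶-uniform : ∀ a ρ → a ⟶ ρ → ∀ ε → 0ℚ < ε → ∃[ K ] (∀ m k → K ℕ.≤ m → K ℕ.≤ k →
              a m < seq ρ k + ε × seq ρ k < a m + ε)
  ⟶-uniform a ρ a⟶ρ ε 0<ε = M ℕ.⊔ N , λ m k M⊔N≤m M⊔N≤k →
    let N≤k = ℕ.m⊔n≤o⇒n≤o M N M⊔N≤k
        (e , 0<e , L , lower) , (e′ , 0<e′ , L′ , upper) = near m (ℕ.m⊔n≤o⇒m≤o M N M⊔N≤m)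
        -- The thresholds `L` and `L′` depend on `m`. The estimate is taken at an index beyond them
        -- and carried over to `k` by the Cauchy property of `ρ`, which makes the final bound
        -- uniform in `m`.
        l  = L ℕ.⊔ N
        l′ = L′ ℕ.⊔ N
    in (begin-strict
         a m
           <⟨ p-q<r⇒p<q+r (a m) (½ * ε) (<-trans
                (<-≤-trans (p<p+q (a m - ½ * ε) 0<e) (lower l (ℕ.m≤m⊔n L N)))
                (close l k (ℕ.m≤n⊔m L N) N≤k)) ⟩
         ½ * ε + (seq ρ k + ½ * ε)
           ≡⟨ halves (seq ρ k) ε ⟩
         seq ρ k + ε
           ∎)
     , (begin-strict
         seq ρ k
           <⟨ close k l′ N≤k (ℕ.m≤n⊔m L′ N) ⟩
         seq ρ l′ + ½ * ε
           <⟨ +-monoˡ-< (½ * ε)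
                (<-≤-trans (p<p+q (seq ρ l′) 0<e′) (upper l′ (ℕ.m≤m⊔n L′ N))) ⟩
         a m + ½ * ε + ½ * ε
           ≡⟨ halves′ (a m) ε ⟩
         a m + ε
           ∎)
    where
    open ≤-Reasoning
    0<½ε = ½-positive 0<ε
    M    = proj₁ (a⟶ρ (½ * ε) 0<½ε)
    near = proj₂ (a⟶ρ (½ * ε) 0<½ε)
    N    = proj₁ (cauchy ρ (½ * ε) 0<½ε)
    close : ∀ k l → N ℕ.≤ k → N ℕ.≤ l → seq ρ k < seq ρ l + ½ * ε
    close k l N≤k N≤l = ∣p-q∣<r⇒p<q+r _ _ (proj₂ (cauchy ρ (½ * ε) 0<½ε) k l N≤k N≤l)
    halves : ∀ x ε → ½ * ε + (x + ½ * ε) ≡ x + ε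
    halves = solve 2 (λ x ε → con ½ :* ε :+ (x :+ con ½ :* ε) := x :+ ε) refl
    halves′ : ∀ x ε → x + ½ * ε + ½ * ε ≡ x + ε
    halves′ = solve 2 (λ x ε → x :+ con ½ :* ε :+ con ½ :* ε := x :+ ε) refl

  -- Adding a convergent sequence shifts an upper limit by its limit. Half of `ε` pays for replacing
  -- `a m` by `seq ρ k`, the other half for the width of the grid.
  limit≃limsup-difference :
    (em : ExcludedMiddle 0ℓ) (ρ : ℝ) (a p p′ : ℕ → ℚ) (C C′ : ℕ)
    (0≤p : ∀ m → 0ℚ ≤ p m) (p≤C : ∀ m → p m ≤ + C / 1)
    (0≤p′ : ∀ m → 0ℚ ≤ p′ m) (p′≤C′ : ∀ m → p′ m ≤ + C′ / 1) →
    a ⟶ ρ → (∀ m → p m ≡ a m + p′ m) →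
    ρ ≃ UpperLimit.limsup em p C 0≤p p≤C -ᴿ UpperLimit.limsup em p′ C′ 0≤p′ p′≤C′
  limit≃limsup-difference em ρ a p p′ C C′ 0≤p p≤C 0≤p′ p′≤C′ a⟶ρ p≡a+p′ ε 0<ε =
    K ℕ.⊔ N , λ k K⊔N≤k →
      let K≤k = ℕ.m⊔n≤o⇒m≤o K N K⊔N≤k
          u≤δ = small k (ℕ.m⊔n≤o⇒n≤o K N K⊔N≤k)
      in ∣p-q∣<r (seq ρ k) (P.lim k - P′.lim k) (ρ<difference k K≤k u≤δ) (difference<ρ k K≤k u≤δ)
    where
    open ≤-Reasoning
    module P  = UpperLimit em p C 0≤p p≤C
    module P′ = UpperLimit em p′ C′ 0≤p′ p′≤C′
    δ     = ½ * ε
    0<δ   = ½-positive 0<ε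
    K     = proj₁ (⟶-uniform a ρ a⟶ρ δ 0<δ)
    near  = proj₂ (⟶-uniform a ρ a⟶ρ δ 0<δ)
    N     = proj₁ (archimedean δ 0<δ)
    small = proj₂ (archimedean δ 0<δ)

    regroup : ∀ r y ε → (r + ½ * ε) + (y + ½ * ε) ≡ y + (r + ε)
    regroup = solve 3 (λ r y ε → (r :+ con ½ :* ε) :+ (y :+ con ½ :* ε) := y :+ (r :+ ε)) refl

    difference<ρ : ∀ k → K ℕ.≤ k → unitFraction k ≤ δ → P.lim k - P′.lim k < seq ρ k + ε
    difference<ρ k K≤k u≤δ = p<q+r⇒p-q<r (P′.lim k) (seq ρ k + ε) (begin-strict
      P.lim k
        <⟨ p-q<r⇒p<q+r (P.lim k) (seq ρ k + δ)
             (<-≤-trans (P′.≤∞⇒<lim+ k shifted) (+-monoʳ-≤ (P′.lim k) u≤δ)) ⟩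
      (seq ρ k + δ) + (P′.lim k + δ)
        ≡⟨ regroup (seq ρ k) (P′.lim k) ε ⟩
      P′.lim k + (seq ρ k + ε)
        ∎)
      where
      shifted : P.lim k - (seq ρ k + δ) ≤∞ p′
      shifted = ≤∞-shift K (seq ρ k + δ) (λ m K≤m → begin
        p m                    ≡⟨ p≡a+p′ m ⟩
        a m + p′ m             ≤⟨ +-monoˡ-≤ (p′ m) (<⇒≤ (proj₁ (near m k K≤m K≤k))) ⟩
        seq ρ k + δ + p′ m     ∎) (P.lim≤∞ k)

    regroup′ : ∀ r x y ε → (½ * ε - r) + (x + ½ * ε) + (r - y) ≡ x - y + ε
    regroup′ = solve 4 (λ r x y ε → (con ½ :* ε :- r) :+ (x :+ con ½ :* ε) :+ (r :- y) := x :- y :+ ε) refl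

    add-subtract : ∀ y r → r ≡ y + (r - y)
    add-subtract = solve 2 (λ y r → r := y :+ (r :- y)) refl

    ρ<difference : ∀ k → K ℕ.≤ k → unitFraction k ≤ δ → seq ρ k < P.lim k - P′.lim k + ε
    ρ<difference k K≤k u≤δ = begin-strict
      seq ρ k
        ≡⟨ add-subtract (P′.lim k) (seq ρ k) ⟩
      P′.lim k + (seq ρ k - P′.lim k)
        <⟨ +-monoˡ-< (seq ρ k - P′.lim k) (p-q<r⇒p<q+r (P′.lim k) (δ - seq ρ k)
             (<-≤-trans (P.≤∞⇒<lim+ k shifted) (+-monoʳ-≤ (P.lim k) u≤δ))) ⟩
      (δ - seq ρ k) + (P.lim k + δ) + (seq ρ k - P′.lim k)
        ≡⟨ regroup′ (seq ρ k) (P.lim k) (P′.lim k) ε ⟩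
      P.lim k - P′.lim k + ε
        ∎
      where
      -- Now the lower estimate on `a m` is used: it bounds `p′ m` by `p m` plus the shift
      -- `δ - seq ρ k`, which may be negative.
      shifted : P′.lim k - (δ - seq ρ k) ≤∞ p
      shifted = ≤∞-shift K (δ - seq ρ k) (λ m K≤m → begin
        p′ m                               ≡⟨ add-subtract (seq ρ k) (p′ m) ⟩
        seq ρ k + (p′ m - seq ρ k)         ≤⟨ +-monoˡ-≤ (p′ m - seq ρ k) (<⇒≤ (proj₂ (near m k K≤m K≤k))) ⟩
        a m + δ + (p′ m - seq ρ k)         ≡⟨ regroup″ (a m) δ (p′ m) (seq ρ k) ⟩
        δ - seq ρ k + (a m + p′ m)         ≡⟨ cong (_+_ (δ - seq ρ k)) (p≡a+p′ m) ⟨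
        δ - seq ρ k + p m                  ∎) (P′.lim≤∞ k)
        where
        regroup″ : ∀ a d y r → a + d + (y - r) ≡ d - r + (a + y)
        regroup″ = solve 4 (λ a d y r → a :+ d :+ (y :- r) := d :- r :+ (a :+ y)) refl

  -- Rises and falls of a Boolean sequence.

  rises : Bool → Bool → Bool
  rises a b = not a ∧ b

  -- Both sides equal `bit (a ∨ b)`.
  rises-balance : ∀ a b → bit a ℕ.+ bit (rises a b) ≡ bit b ℕ.+ bit (rises b a)
  rises-balance false false = refl
  rises-balance false true  = refl
  rises-balance true  false = refl
  rises-balance true  true  = refl

  -- Writes a rise as a truncated difference, which makes `ups` and `downs` computable.
  rises-bit : ∀ a b → bit b ℕ.∸ bit a ≡ bit (rises a b)
  rises-bit false false = refl
  rises-bit false true  = refl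
  rises-bit true  false = refl
  rises-bit true  true  = refl

  rises-self : ∀ a → rises a a ≡ false
  rises-self false = refl
  rises-self true  = refl

  rises⇒≢ : ∀ {a b} → rises a b ≡ true → a ≢ b
  rises⇒≢ {a} r refl with trans (sym r) (rises-self a)
  ... | ()

  ups downs : (ℕ → Bool) → ℕ → Bool
  ups   f s = rises (f s) (f (suc s))
  downs f s = rises (f (suc s)) (f s)

  -- Telescoping: the current value is the initial value, here 0, plus rises minus falls. The
  -- additive form avoids subtraction.
  ∑<-ups : ∀ f → f 0 ≡ false → ∀ t → ∑< t (bit ∘ ups f) ≡ bit (f t) ℕ.+ ∑< t (bit ∘ downs f)
  ∑<-ups f f0 zero    rewrite f0 = refl
  ∑<-ups f f0 (suc t) = begin
    U ℕ.+ bit (ups f t)                     ≡⟨ cong (ℕ._+ bit (ups f t)) (∑<-ups f f0 t) ⟩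
    bit (f t) ℕ.+ D ℕ.+ bit (ups f t)       ≡⟨ xy∙z≈xz∙y ℕ.+-commutativeSemigroup (bit (f t)) D _ ⟩
    bit (f t) ℕ.+ bit (ups f t) ℕ.+ D       ≡⟨ cong (ℕ._+ D) (rises-balance (f t) (f (suc t))) ⟩
    bit (f (suc t)) ℕ.+ bit (downs f t) ℕ.+ D ≡⟨ ℕ.+-assoc (bit (f (suc t))) _ D ⟩
    bit (f (suc t)) ℕ.+ (bit (downs f t) ℕ.+ D) ≡⟨ cong (bit (f (suc t)) ℕ.+_) (ℕ.+-comm (bit (downs f t)) D) ⟩
    bit (f (suc t)) ℕ.+ (D ℕ.+ bit (downs f t)) ∎
    where
    open ≡-Reasoning
    U = ∑< t (bit ∘ ups f)
    D = ∑< t (bit ∘ downs f)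

  module _ {g : ℕ → ℕ → Bool} (computable-g : Computable (onVec₂ g)) where

    private
      value : Computableℕ {2} (λ xs → bit (g (lookup xs zero) (lookup xs (suc zero))))
      value = apply₂ {f = bit ∘ onVec₂ g} computable-g (var zero) (var (suc zero))

      nextValue : Computableℕ {2} (λ xs → bit (g (lookup xs zero) (suc (lookup xs (suc zero)))))
      nextValue = apply₂ {f = bit ∘ onVec₂ g} computable-g (var zero) (sucᶜ (var (suc zero)))

    computable-ups : Computable (onVec₂ (λ x → ups (g x)))
    computable-ups = computable-≗
      (λ { (x ∷ s ∷ []) → rises-bit (g x s) (g x (suc s)) }) (nextValue ∸ᶜ value)

    computable-downs : Computable (onVec₂ (λ x → downs (g x)))
    computable-downs = computable-≗
      (λ { (x ∷ s ∷ []) → rises-bit (g x (suc s)) (g x s) }) (value ∸ᶜ nextValue)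

  average-+ : ∀ v w m → average (λ x → v x ℕ.+ w x) m ≡ average v m + average w m
  average-+ v w m = trans (cong (λ i → + i / suc m) (∑<-+ (suc m) v w))
    (/-distrib-+ (+ ∑< (suc m) v) (+ ∑< (suc m) w) m)

  average-cong : ∀ {v w} → v ≗ w → ∀ m → average v m ≡ average w m
  average-cong v≗w m = cong (λ i → + i / suc m) (∑<-cong (suc m) v≗w)

  partialDensity≡average : ∀ A m → partialDensity A (suc m) ≡ average (bit ∘ A) m
  partialDensity≡average A m = cong (λ i → + i / suc m) (length-filterᵇ-upTo A (suc m))

-- Densities of n-c.e. sets.

open import Data.Nat using (_≤_)

theorem4p2 : ExcludedMiddle 0ℓ →
    ∀ (n : ℕ) → 1 ≤ n →
    ∀ (A : ℕ → Bool) → n -CE A →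
    ∀ (ρ : ℝ) → HasDensity A ρ →
    ∃[ r ] ∃[ s ] (LeftΠ⁰₂ r × LeftΠ⁰₂ s × ρ ≃ r -ᴿ s)
theorem4p2 em n 1≤n A (g , computable-g , g0 , g→A , changes) ρ A⟶ρ =
  Up.limsup , Down.limsup , Up.limsup-LeftΠ⁰₂ , Down.limsup-LeftΠ⁰₂ ,
  limit≃limsup-difference em ρ
    (λ m → partialDensity A (suc m)) (average Up.total) (average Down.total) n n
    Up.0≤average Up.average≤n Down.0≤average Down.average≤n A⟶ρ ups≡A+downs
  where
  changes≤n : ∀ x p → (∀ s → p s ≡ true → g x s ≢ g x (suc s)) → ∀ t → ∑< t (bit ∘ p) ℕ.≤ n
  changes≤n x p p⇒change t =
    let xs , ∣xs∣≤n , covers = changes x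
    in ℕ.≤-trans (∑<-bit≤length p (λ s ps → covers s (p⇒change s ps)) t) ∣xs∣≤n

  constant : ∀ x s → proj₁ (g→A x) ℕ.≤ s → g x s ≡ g x (suc s)
  constant x s s₀≤s = trans (proj₂ (g→A x) s s₀≤s) (sym (proj₂ (g→A x) (suc s) (ℕ.m≤n⇒m≤1+n s₀≤s)))

  module Up = FiniteCounts em (λ x → ups (g x)) (computable-ups computable-g) n
    (λ x → changes≤n x (ups (g x)) (λ s → rises⇒≢))
    (λ x → proj₁ (g→A x) , λ s s₀≤s →
       trans (cong (rises (g x s)) (sym (constant x s s₀≤s))) (rises-self (g x s)))

  module Down = FiniteCounts em (λ x → downs (g x)) (computable-downs computable-g) n
    (λ x → changes≤n x (downs (g x)) (λ s r eq → rises⇒≢ r (sym eq)))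
    (λ x → proj₁ (g→A x) , λ s s₀≤s →
       trans (cong (λ b → rises b (g x s)) (sym (constant x s s₀≤s))) (rises-self (g x s)))

  ups≡A+downs : ∀ m → average Up.total m ≡ partialDensity A (suc m) ℚ.+ average Down.total m
  ups≡A+downs m = begin
    average Up.total m                                   ≡⟨ average-cong total≡ m ⟩
    average (λ x → bit (A x) ℕ.+ Down.total x) m         ≡⟨ average-+ (bit ∘ A) Down.total m ⟩
    average (bit ∘ A) m ℚ.+ average Down.total m           ≡⟨ cong (ℚ._+ average Down.total m) (partialDensity≡average A m) ⟨
    partialDensity A (suc m) ℚ.+ average Down.total m      ∎
    where
    open ≡-Reasoning
    total≡ : ∀ x → Up.total x ≡ bit (A x) ℕ.+ Down.total x
    -- `Up` and `Down` are given the same settling stage `proj₁ (g→A x)`, so both totals are sums up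
    -- to that stage, where `g x` already has the value `A x`.
    total≡ x = trans (∑<-ups (g x) (g0 x) (proj₁ (g→A x)))
      (cong (λ b → bit b ℕ.+ Down.total x) (proj₂ (g→A x) _ ℕ.≤-refl))
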